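{- For integers $m>j\geq 0$ and $n\geq 1$, \[ \sum_{i=0}^{n-1}T_{mi+j}=\frac{T_{mn+m+j}+T_{mn-m+j}+(1-K_{m})T_{mn+j}}{K_{m}-K_{ -m}}-\frac{T_{m+j}+T_{j-m}+(1-K_{m})T_{j}}{K_{m}-K_{ -m}} \] and \[ \sum_{i=0}^{n-1}K_{mi+j}=\frac{K_{mn+m+j}+K_{mn-m+j}+(1-K_{m})K_{mn+j}}{K_{m}-K_{ -m}}-\frac{K_{m+j}+K_{j-m}+(1-K_{m})K_{j}}{K_{m}-K_{ -m}}. \]
   Context: The Tribonacci numbers $T_n$ and Tribonacci–Lucas numbers $K_n$ are defined for all integers $n$ by $T_n=T_{n-1}+T_{n-2}+T_{n-3}$ with $T_0=0,T_1=1,T_2=1$, and $K_n=K_{n-1}+K_{n-2}+K_{n-3}$ with $K_0=3,K_1=1,K_2=3$; negative indices are defined by running the recurrences backwards, i.e. $T_{ -n}=-T_{ -(n-1)}-T_{ -(n-2)}+T_{ -(n-3)}$ and $K_{ -n}=-K_{ -(n-1)}-K_{ -(n-2)}+K_{ -(n-3)}$ for $n\geq 1$. -}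

module Defs where

open import Data.Nat as ℕ using (ℕ; zero; suc)
open import Data.Integer using (ℤ; +_; -[1+_]; _+_; _-_; -_; _*_)

fwd : ℤ → ℤ → ℤ → ℕ → ℤ
fwd a b c zero = a
fwd a b c (suc n) = fwd b c (a + b + c) n

-- Backward extension: bwd gives s (-(n)) for n ≥ 0, using
-- s (-n) = - s (-(n-1)) - s (-(n-2)) + s (-(n-3)),
-- i.e. s k = s (k+3) - s (k+2) - s (k+1).
-- bwd x y z n: starting from (x,y,z) = (s 0, s 1, s 2).
bwd : ℤ → ℤ → ℤ → ℕ → ℤ
bwd x y z zero = x
bwd x y z (suc n) = bwd (z - y - x) x y n

seqℤ : ℤ → ℤ → ℤ → ℤ → ℤ
seqℤ a b c (+ n) = fwd a b c n
seqℤ a b c -[1+ n ] = bwd a b c (suc n)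

T : ℤ → ℤ
T = seqℤ (+ 0) (+ 1) (+ 1)

K : ℤ → ℤ
K = seqℤ (+ 3) (+ 1) (+ 3)

sumTo : ℕ → (ℕ → ℤ) → ℤ
sumTo zero f = + 0
sumTo (suc n) f = sumTo n f + f n

-- In ℤ[τ] = ℤ[x]/(x³ − x² − x − 1) the element a + bτ + cτ² acts on a sequence s
-- satisfying the Tribonacci recurrence as a + bE + cE², E the shift. The trace of τⁿ
-- is Kₙ, and since τ has norm 1 the adjugate of τⁿ is τ⁻ⁿ, of trace K₋ₙ. Cayley–Hamilton
-- for u = τᵐ therefore gives s(k + 3m) − Kₘ s(k + 2m) + K₋ₘ s(k + m) − s(k) = 0, which
-- makes G(n) = s(mn + m + j) + s(mn − m + j) + (1 − Kₘ) s(mn + j) telescope: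
-- G(n + 1) − G(n) = (Kₘ − K₋ₘ) s(mn + j). Finally Kₘ ≠ K₋ₘ for m ≥ 1, since the
-- alternating backward recurrence keeps |K₋ₙ| below Kₙ for n ≥ 2.
{-# OPTIONS --safe #-}
module Submission where

open import Defs
open import Data.Nat as ℕ using (ℕ; zero; suc)
import Data.Nat.Properties as ℕₚ
open import Data.Integer using (ℤ; +_; -[1+_]; _+_; _-_; -_; _*_; _<_; _≤_; -≤+; -<+; -<-; +<+)
import Data.Integer.Properties as ℤ
open import Data.Integer.Tactic.RingSolver using (solve-∀; solve)
open import Data.List using (_∷_; [])
open import Data.Product using (_×_; _,_; proj₂; map)
open import Relation.Binary.PropositionalEquality

+-reverse : ∀ a b c → a + b + c ≡ c + b + a
+-reverse = solve-∀

fwd-tribonacci : ∀ a b c n →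
  fwd a b c (3 ℕ.+ n) ≡ fwd a b c (2 ℕ.+ n) + fwd a b c (1 ℕ.+ n) + fwd a b c n
fwd-tribonacci a b c zero = +-reverse a b c
fwd-tribonacci a b c (suc n) = fwd-tribonacci b c (a + b + c) n

bwd-tribonacci : ∀ x y z n →
  bwd x y z (3 ℕ.+ n) ≡ bwd x y z n - bwd x y z (1 ℕ.+ n) - bwd x y z (2 ℕ.+ n)
bwd-tribonacci x y z zero = refl
bwd-tribonacci x y z (suc n) = bwd-tribonacci (z - y - x) x y n

i≡j+k+[i-j-k] : ∀ i j k → i ≡ j + k + (i - j - k)
i≡j+k+[i-j-k] = solve-∀

cong₃ : ∀ {A B C D : Set} (f : A → B → C → D) {a a′ b b′ c c′} →
        a ≡ a′ → b ≡ b′ → c ≡ c′ → f a b c ≡ f a′ b′ c′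
cong₃ f refl refl refl = refl

IsTribonacci : (ℤ → ℤ) → Set
IsTribonacci s = ∀ k → s (k + + 3) ≡ s (k + + 2) + s (k + + 1) + s k

seqℤ-tribonacci : ∀ a b c → IsTribonacci (seqℤ a b c)
seqℤ-tribonacci a b c (+ n)
  rewrite ℕₚ.+-comm n 3 | ℕₚ.+-comm n 2 | ℕₚ.+-comm n 1 = fwd-tribonacci a b c n
seqℤ-tribonacci a b c -[1+ 0 ] = i≡j+k+[i-j-k] c b a
seqℤ-tribonacci a b c -[1+ 1 ] = i≡j+k+[i-j-k] b a (c - b - a)
seqℤ-tribonacci a b c -[1+ 2 ] = i≡j+k+[i-j-k] a (c - b - a) (b - a - (c - b - a))
seqℤ-tribonacci a b c -[1+ suc (suc (suc n)) ] =
  trans (i≡j+k+[i-j-k] (bwd a b c (1 ℕ.+ n)) (bwd a b c (2 ℕ.+ n)) (bwd a b c (3 ℕ.+ n)))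
        (cong (_+_ (bwd a b c (2 ℕ.+ n) + bwd a b c (3 ℕ.+ n))) (sym (bwd-tribonacci a b c (suc n))))

K-tribonacci : IsTribonacci K
K-tribonacci = seqℤ-tribonacci (+ 3) (+ 1) (+ 3)

T-tribonacci : IsTribonacci T
T-tribonacci = seqℤ-tribonacci (+ 0) (+ 1) (+ 1)

-- a + bτ + cτ², where τ³ = τ² + τ + 1
record ℤ[τ] : Set where
  constructor ⟨_,_,_⟩
  field c₀ c₁ c₂ : ℤ

infixl 6 _⊕_
infixr 7 _·_ _⊛_
infixr 8 τ·_ τ^_


ι : ℤ → ℤ[τ]
ι n = ⟨ n , + 0 , + 0 ⟩

_⊕_ : ℤ[τ] → ℤ[τ] → ℤ[τ]
⟨ a , b , c ⟩ ⊕ ⟨ x , y , z ⟩ = ⟨ a + x , b + y , c + z ⟩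

_⊛_ : ℤ → ℤ[τ] → ℤ[τ]
n ⊛ ⟨ a , b , c ⟩ = ⟨ n * a , n * b , n * c ⟩

-- reduced with τ³ = 1 + τ + τ² and τ⁴ = 1 + 2τ + 2τ²
_·_ : ℤ[τ] → ℤ[τ] → ℤ[τ]
⟨ a , b , c ⟩ · ⟨ x , y , z ⟩ =
  ⟨ a * x + (b * z + c * y) + c * z
  , (a * y + b * x) + (b * z + c * y) + + 2 * (c * z)
  , (a * z + b * y + c * x) + (b * z + c * y) + + 2 * (c * z) ⟩

τ·_ : ℤ[τ] → ℤ[τ]
τ· ⟨ a , b , c ⟩ = ⟨ c , a + c , b + c ⟩

τ^_ : ℕ → ℤ[τ]
τ^ zero = ι (+ 1)
τ^ suc n = τ· τ^ n

tr : ℤ[τ] → ℤ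
tr ⟨ a , b , c ⟩ = a * + 3 + b * + 1 + c * + 3

adj : ℤ[τ] → ℤ[τ]
adj ⟨ a , b , c ⟩ =
  ⟨ a * a + a * b + + 3 * (a * c) - b * b - + 2 * (b * c)
  , + 2 * (c * c) - a * b - b * b - b * c
  , b * b + b * c - a * c - c * c ⟩

norm : ℤ[τ] → ℤ
norm u = ℤ[τ].c₀ (u · adj u)

-- The ring solver does not look inside applications of the operations above, so each
-- identity in ℤ[τ] is first stated with its components written out.
ι1-· : ∀ u → ι (+ 1) · u ≡ u
ι1-· ⟨ x , y , z ⟩ = expanded x y z
  where
  expanded : ∀ x y z →
    ⟨ + 1 * x + (+ 0 * z + + 0 * y) + + 0 * z
    , (+ 1 * y + + 0 * x) + (+ 0 * z + + 0 * y) + + 2 * (+ 0 * z)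
    , (+ 1 * z + + 0 * y + + 0 * x) + (+ 0 * z + + 0 * y) + + 2 * (+ 0 * z) ⟩ ≡ ⟨ x , y , z ⟩
  expanded x y z = cong₃ ⟨_,_,_⟩
    (solve (x ∷ y ∷ z ∷ [])) (solve (x ∷ y ∷ z ∷ [])) (solve (x ∷ y ∷ z ∷ []))

τ·-assoc : ∀ u w → (τ· u) · w ≡ τ· (u · w)
τ·-assoc ⟨ a , b , c ⟩ ⟨ x , y , z ⟩ = expanded a b c x y z
  where
  expanded : ∀ a b c x y z →
    let a₁ = c ; b₁ = a + c ; c₁ = b + c
        p = a * x + (b * z + c * y) + c * z
        q = (a * y + b * x) + (b * z + c * y) + + 2 * (c * z)
        r = (a * z + b * y + c * x) + (b * z + c * y) + + 2 * (c * z)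
    in ⟨ a₁ * x + (b₁ * z + c₁ * y) + c₁ * z
       , (a₁ * y + b₁ * x) + (b₁ * z + c₁ * y) + + 2 * (c₁ * z)
       , (a₁ * z + b₁ * y + c₁ * x) + (b₁ * z + c₁ * y) + + 2 * (c₁ * z) ⟩
       ≡ ⟨ r , p + r , q + r ⟩
  expanded a b c x y z = cong₃ ⟨_,_,_⟩
    (solve (a ∷ b ∷ c ∷ x ∷ y ∷ z ∷ []))
    (solve (a ∷ b ∷ c ∷ x ∷ y ∷ z ∷ []))
    (solve (a ∷ b ∷ c ∷ x ∷ y ∷ z ∷ []))

·-adj : ∀ u → u · adj u ≡ ι (norm u)
·-adj ⟨ a , b , c ⟩ = expanded a b c
  where
  expanded : ∀ a b c →
    let a′ = a * a + a * b + + 3 * (a * c) - b * b - + 2 * (b * c)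
        b′ = + 2 * (c * c) - a * b - b * b - b * c
        c′ = b * b + b * c - a * c - c * c
        n = a * a′ + (b * c′ + c * b′) + c * c′
    in ⟨ n
       , (a * b′ + b * a′) + (b * c′ + c * b′) + + 2 * (c * c′)
       , (a * c′ + b * b′ + c * a′) + (b * c′ + c * b′) + + 2 * (c * c′) ⟩
       ≡ ι n
  expanded a b c = cong₃ ⟨_,_,_⟩ refl (solve (a ∷ b ∷ c ∷ [])) (solve (a ∷ b ∷ c ∷ []))

norm-τ· : ∀ u → norm (τ· u) ≡ norm u
norm-τ· ⟨ a , b , c ⟩ = expanded a b c
  where
  expanded : ∀ a b c →
    let N : ℤ → ℤ → ℤ → ℤ
        N a b c =
          let a′ = a * a + a * b + + 3 * (a * c) - b * b - + 2 * (b * c)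
              b′ = + 2 * (c * c) - a * b - b * b - b * c
              c′ = b * b + b * c - a * c - c * c
          in a * a′ + (b * c′ + c * b′) + c * c′
    in N c (a + c) (b + c) ≡ N a b c
  expanded = solve-∀

cayley-hamilton : ∀ u → u · u · u ⊕ tr (adj u) ⊛ u ≡ tr u ⊛ u · u ⊕ ι (norm u)
cayley-hamilton ⟨ a , b , c ⟩ = expanded a b c
  where
  expanded : ∀ a b c →
    let x = a * a + (b * c + c * b) + c * c
        y = (a * b + b * a) + (b * c + c * b) + + 2 * (c * c)
        z = (a * c + b * b + c * a) + (b * c + c * b) + + 2 * (c * c)
        a′ = a * a + a * b + + 3 * (a * c) - b * b - + 2 * (b * c)
        b′ = + 2 * (c * c) - a * b - b * b - b * c
        c′ = b * b + b * c - a * c - c * c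
        t = a * + 3 + b * + 1 + c * + 3
        e = a′ * + 3 + b′ * + 1 + c′ * + 3
        n = a * a′ + (b * c′ + c * b′) + c * c′
    in ⟨ a * x + (b * z + c * y) + c * z + e * a
       , (a * y + b * x) + (b * z + c * y) + + 2 * (c * z) + e * b
       , (a * z + b * y + c * x) + (b * z + c * y) + + 2 * (c * z) + e * c ⟩
       ≡ ⟨ t * x + n , t * y + + 0 , t * z + + 0 ⟩
  expanded a b c = cong₃ ⟨_,_,_⟩
    (solve (a ∷ b ∷ c ∷ [])) (solve (a ∷ b ∷ c ∷ [])) (solve (a ∷ b ∷ c ∷ []))

-- ⟦ a + bτ + cτ² ⟧ s = (a + bE + cE²) s for the shift E s = s ∘ (_+ + 1); on sequences
-- with E³ = E² + E + 1 this is an action of ℤ[τ].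
⟦_⟧ : ℤ[τ] → (ℤ → ℤ) → ℤ → ℤ
⟦ ⟨ a , b , c ⟩ ⟧ s k = a * s k + b * s (k + + 1) + c * s (k + + 2)

module _ (s : ℤ → ℤ) where

  ⟦⟧-⊕ : ∀ u w k → ⟦ u ⊕ w ⟧ s k ≡ ⟦ u ⟧ s k + ⟦ w ⟧ s k
  ⟦⟧-⊕ ⟨ a , b , c ⟩ ⟨ x , y , z ⟩ k = expanded a b c x y z (s k) (s (k + + 1)) (s (k + + 2))
    where
    expanded : ∀ a b c x y z p q r →
      (a + x) * p + (b + y) * q + (c + z) * r ≡ (a * p + b * q + c * r) + (x * p + y * q + z * r)
    expanded = solve-∀

  ⟦⟧-⊛ : ∀ n u k → ⟦ n ⊛ u ⟧ s k ≡ n * ⟦ u ⟧ s k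
  ⟦⟧-⊛ n ⟨ a , b , c ⟩ k = expanded n a b c (s k) (s (k + + 1)) (s (k + + 2))
    where
    expanded : ∀ n a b c p q r → n * a * p + n * b * q + n * c * r ≡ n * (a * p + b * q + c * r)
    expanded = solve-∀

  ⟦⟧-ι : ∀ n k → ⟦ ι n ⟧ s k ≡ n * s k
  ⟦⟧-ι n k = expanded n (s k) (s (k + + 1)) (s (k + + 2))
    where
    expanded : ∀ n p q r → n * p + + 0 * q + + 0 * r ≡ n * p
    expanded = solve-∀

module Shift (s : ℤ → ℤ) (tribonacci : IsTribonacci s) where

  ⟦⟧-τ· : ∀ u k → ⟦ τ· u ⟧ s k ≡ ⟦ u ⟧ s (k + + 1)
  ⟦⟧-τ· ⟨ a , b , c ⟩ k
    rewrite ℤ.+-assoc k (+ 1) (+ 1) | ℤ.+-assoc k (+ 1) (+ 2) | tribonacci k =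
      expanded a b c (s k) (s (k + + 1)) (s (k + + 2))
    where
    expanded : ∀ a b c p q r → c * p + (a + c) * q + (b + c) * r ≡ a * q + b * r + c * (r + q + p)
    expanded = solve-∀

  ⟦⟧-τ^· : ∀ n w k → ⟦ τ^ n · w ⟧ s k ≡ ⟦ w ⟧ s (k + + n)
  ⟦⟧-τ^· zero w k = cong₂ (λ v i → ⟦ v ⟧ s i) (ι1-· w) (sym (ℤ.+-identityʳ k))
  ⟦⟧-τ^· (suc n) w k = begin
    ⟦ (τ· τ^ n) · w ⟧ s k     ≡⟨ cong (λ v → ⟦ v ⟧ s k) (τ·-assoc (τ^ n) w) ⟩
    ⟦ τ· (τ^ n · w) ⟧ s k     ≡⟨ ⟦⟧-τ· (τ^ n · w) k ⟩
    ⟦ τ^ n · w ⟧ s (k + + 1)  ≡⟨ ⟦⟧-τ^· n w (k + + 1) ⟩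
    ⟦ w ⟧ s (k + + 1 + + n)   ≡⟨ cong (⟦ w ⟧ s) (ℤ.+-assoc k (+ 1) (+ n)) ⟩
    ⟦ w ⟧ s (k + + suc n)     ∎
    where open ≡-Reasoning

  ⟦⟧-τ^ : ∀ n k → ⟦ τ^ n ⟧ s k ≡ s (k + + n)
  ⟦⟧-τ^ zero k =
    trans (⟦⟧-ι s (+ 1) k) (trans (ℤ.*-identityˡ (s k)) (cong s (sym (ℤ.+-identityʳ k))))
  ⟦⟧-τ^ (suc n) k = begin
    ⟦ τ· τ^ n ⟧ s k          ≡⟨ ⟦⟧-τ· (τ^ n) k ⟩
    ⟦ τ^ n ⟧ s (k + + 1)     ≡⟨ ⟦⟧-τ^ n (k + + 1) ⟩
    s (k + + 1 + + n)        ≡⟨ cong s (ℤ.+-assoc k (+ 1) (+ n)) ⟩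
    s (k + + suc n)          ∎
    where open ≡-Reasoning

tr-τ^ : ∀ n → tr (τ^ n) ≡ K (+ n)
tr-τ^ n = Shift.⟦⟧-τ^ K K-tribonacci n (+ 0)

norm-τ^ : ∀ n → norm (τ^ n) ≡ + 1
norm-τ^ zero = refl
norm-τ^ (suc n) = trans (norm-τ· (τ^ n)) (norm-τ^ n)

tr-adj-τ^ : ∀ n → tr (adj (τ^ n)) ≡ K (- + n)
tr-adj-τ^ n = begin
  ⟦ adj u ⟧ K (+ 0)            ≡⟨ cong (⟦ adj u ⟧ K) (sym (ℤ.+-inverseˡ (+ n))) ⟩
  ⟦ adj u ⟧ K (- + n + + n)    ≡⟨ sym (Shift.⟦⟧-τ^· K K-tribonacci n (adj u) (- + n)) ⟩
  ⟦ u · adj u ⟧ K (- + n)      ≡⟨ cong (λ v → ⟦ v ⟧ K (- + n)) (·-adj u) ⟩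
  ⟦ ι (norm u) ⟧ K (- + n)     ≡⟨ ⟦⟧-ι K (norm u) (- + n) ⟩
  norm u * K (- + n)          ≡⟨ cong (_* K (- + n)) (norm-τ^ n) ⟩
  + 1 * K (- + n)             ≡⟨ ℤ.*-identityˡ (K (- + n)) ⟩
  K (- + n)                   ∎
  where
  open ≡-Reasoning
  u = τ^ n

subsequence-recurrence : ∀ s → IsTribonacci s → ∀ M k →
  s (k + + M + + M + + M) + K (- + M) * s (k + + M) ≡ K (+ M) * s (k + + M + + M) + s k
subsequence-recurrence s tribonacci M k = begin
  s (k + m + m + m) + K (- m) * s (k + m)
    ≡⟨ sym (cong₂ (λ p q → p + K (- m) * q) cube (⟦⟧-τ^ M k)) ⟩
  ⟦ u · u · u ⟧ s k + K (- m) * ⟦ u ⟧ s k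
    ≡⟨ cong (λ e → ⟦ u · u · u ⟧ s k + e * ⟦ u ⟧ s k) (sym (tr-adj-τ^ M)) ⟩
  ⟦ u · u · u ⟧ s k + tr (adj u) * ⟦ u ⟧ s k
    ≡⟨ sym (trans (⟦⟧-⊕ s (u · u · u) (tr (adj u) ⊛ u) k)
                  (cong (_+_ (⟦ u · u · u ⟧ s k)) (⟦⟧-⊛ s (tr (adj u)) u k))) ⟩
  ⟦ u · u · u ⊕ tr (adj u) ⊛ u ⟧ s k
    ≡⟨ cong (λ v → ⟦ v ⟧ s k) (cayley-hamilton u) ⟩
  ⟦ tr u ⊛ u · u ⊕ ι (norm u) ⟧ s k
    ≡⟨ trans (⟦⟧-⊕ s (tr u ⊛ u · u) (ι (norm u)) k)
             (cong₂ _+_ (⟦⟧-⊛ s (tr u) (u · u) k) (⟦⟧-ι s (norm u) k)) ⟩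
  tr u * ⟦ u · u ⟧ s k + norm u * s k
    ≡⟨ cong₂ (λ t n → t * ⟦ u · u ⟧ s k + n * s k) (tr-τ^ M) (norm-τ^ M) ⟩
  K m * ⟦ u · u ⟧ s k + + 1 * s k
    ≡⟨ cong₂ (λ p q → K m * p + q) square (ℤ.*-identityˡ (s k)) ⟩
  K m * s (k + m + m) + s k ∎
  where
  open ≡-Reasoning
  open Shift s tribonacci
  m = + M
  u = τ^ M
  square : ⟦ u · u ⟧ s k ≡ s (k + m + m)
  square = trans (⟦⟧-τ^· M u k) (⟦⟧-τ^ M (k + m))
  cube : ⟦ u · u · u ⟧ s k ≡ s (k + m + m + m)
  cube = trans (⟦⟧-τ^· M (u · u) k) (trans (⟦⟧-τ^· M u (k + m)) (⟦⟧-τ^ M (k + m + m)))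

telescope : ∀ (f g : ℕ → ℤ) d → (∀ n → g (suc n) ≡ g n + d * f n) →
            ∀ n → d * sumTo n f ≡ g n - g 0
telescope f g d step zero = trans (ℤ.*-zeroʳ d) (sym (ℤ.+-inverseʳ (g 0)))
telescope f g d step (suc n) = begin
  d * (sumTo n f + f n)    ≡⟨ ℤ.*-distribˡ-+ d (sumTo n f) (f n) ⟩
  d * sumTo n f + d * f n  ≡⟨ cong (_+ d * f n) (telescope f g d step n) ⟩
  g n - g 0 + d * f n      ≡⟨ swap (g n) (g 0) (d * f n) ⟩
  g n + d * f n - g 0      ≡⟨ cong (_- g 0) (sym (step n)) ⟩
  g (suc n) - g 0          ∎
  where
  open ≡-Reasoning
  swap : ∀ x y z → x - y + z ≡ x + z - y
  swap = solve-∀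

module Progression (s : ℤ → ℤ) (m j A B : ℤ)
  (recurrence : ∀ k → s (k + m + m + m) + B * s (k + m) ≡ A * s (k + m + m) + s k) where

  G : ℕ → ℤ
  G n = s (m * + n + m + j) + s (m * + n - m + j) + (+ 1 - A) * s (m * + n + j)

  g : ℤ → ℤ
  g y = s (y + m + m) + s y + (+ 1 - A) * s (y + m)

  start : ℕ → ℤ
  start n = m * + n - m + j

  g-step : ∀ y → g (y + m) ≡ g y + (A - B) * s (y + m)
  g-step y = rearranged (s y) (s (y + m)) (s (y + m + m)) (s (y + m + m + m)) (recurrence y)
    where
    rearranged : ∀ p q r t → t + B * q ≡ A * r + p →
                 t + q + (+ 1 - A) * r ≡ r + p + (+ 1 - A) * q + (A - B) * q
    rearranged p q r t h = begin
      t + q + (+ 1 - A) * r                    ≡⟨ solve (A ∷ B ∷ q ∷ r ∷ t ∷ []) ⟩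
      t + B * q + (q - B * q + (+ 1 - A) * r)  ≡⟨ cong (_+ (q - B * q + (+ 1 - A) * r)) h ⟩
      A * r + p + (q - B * q + (+ 1 - A) * r)  ≡⟨ solve (A ∷ B ∷ p ∷ q ∷ r ∷ []) ⟩
      r + p + (+ 1 - A) * q + (A - B) * q      ∎
      where open ≡-Reasoning

  offset-top : ∀ n → m * + n + m + j ≡ start n + m + m
  offset-top n = identity m (+ n) j
    where
    identity : ∀ m i j → m * i + m + j ≡ m * i - m + j + m + m
    identity = solve-∀

  offset-mid : ∀ n → m * + n + j ≡ start n + m
  offset-mid n = identity m (+ n) j
    where
    identity : ∀ m i j → m * i + j ≡ m * i - m + j + m
    identity = solve-∀

  start-suc : ∀ n → start (suc n) ≡ start n + m
  start-suc n = identity m (+ n) j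
    where
    identity : ∀ m i j → m * (+ 1 + i) - m + j ≡ m * i - m + j + m
    identity = solve-∀

  G≡g∘start : ∀ n → G n ≡ g (start n)
  G≡g∘start n = cong₂ (λ p q → s p + s (start n) + (+ 1 - A) * s q) (offset-top n) (offset-mid n)

  G-step : ∀ n → G (suc n) ≡ G n + (A - B) * s (m * + n + j)
  G-step n = begin
    G (suc n)                                ≡⟨ G≡g∘start (suc n) ⟩
    g (start (suc n))                        ≡⟨ cong g (start-suc n) ⟩
    g (start n + m)                          ≡⟨ g-step (start n) ⟩
    g (start n) + (A - B) * s (start n + m)  ≡⟨ cong₂ (λ p q → p + (A - B) * s q)
                                                       (sym (G≡g∘start n)) (sym (offset-mid n)) ⟩
    G n + (A - B) * s (m * + n + j)          ∎
    where open ≡-Reasoning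

  G-zero : G 0 ≡ s (m + j) + s (j - m) + (+ 1 - A) * s j
  G-zero = cong₃ (λ p q r → s p + s q + (+ 1 - A) * s r) (top m j) (mid m j) (bottom m j)
    where
    top : ∀ m j → m * + 0 + m + j ≡ m + j
    top = solve-∀
    mid : ∀ m j → m * + 0 - m + j ≡ j - m
    mid = solve-∀
    bottom : ∀ m j → m * + 0 + j ≡ j
    bottom = solve-∀

  progression-sum : ∀ n →
    (A - B) * sumTo n (λ i → s (m * + i + j))
      ≡ (s (m * + n + m + j) + s (m * + n - m + j) + (+ 1 - A) * s (m * + n + j))
        - (s (m + j) + s (j - m) + (+ 1 - A) * s j)
  progression-sum n =
    trans (telescope (λ i → s (m * + i + j)) G (A - B) G-step n) (cong (_-_ (G n)) G-zero)

infix 4 ∣_∣≤_ ∣_∣<_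

∣_∣≤_ : ℤ → ℤ → Set
∣ x ∣≤ y = - y ≤ x × x ≤ y

∣_∣<_ : ℤ → ℤ → Set
∣ x ∣< y = - y < x × x < y

∣∣<⇒∣∣≤ : ∀ {x y} → ∣ x ∣< y → ∣ x ∣≤ y
∣∣<⇒∣∣≤ = map ℤ.<⇒≤ ℤ.<⇒≤

neg-flip-≤ : ∀ {x y} → - x ≤ y → - y ≤ x
neg-flip-≤ {x} {y} h = subst (- y ≤_) (ℤ.neg-involutive x) (ℤ.neg-mono-≤ h)

neg-flip-< : ∀ {x y} → - x < y → - y < x
neg-flip-< {x} {y} h = subst (- y <_) (ℤ.neg-involutive x) (ℤ.neg-mono-< h)

∣x-y-z∣< : ∀ {x y z a b c} → ∣ x ∣≤ a → ∣ y ∣≤ b → ∣ z ∣< c → ∣ x - y - z ∣< c + b + a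
∣x-y-z∣< {x} {y} {z} {a} {b} {c} (-a≤x , x≤a) (-b≤y , y≤b) (-c<z , z<c) = lower , upper
  where
  negated-sum : ∀ a b c → - a + - b + - c ≡ - (c + b + a)
  negated-sum = solve-∀
  lower : - (c + b + a) < x - y - z
  lower = subst (_< x - y - z) (negated-sum a b c)
    (ℤ.+-mono-≤-< (ℤ.+-mono-≤ -a≤x (ℤ.neg-mono-≤ y≤b)) (ℤ.neg-mono-< z<c))
  upper : x - y - z < c + b + a
  upper = subst (x - y - z <_) (+-reverse a b c)
    (ℤ.+-mono-≤-< (ℤ.+-mono-≤ x≤a (neg-flip-≤ -b≤y)) (neg-flip-< -c<z))

dominated : ∀ (p q : ℕ → ℤ) →
  (∀ n → p (3 ℕ.+ n) ≡ p (2 ℕ.+ n) + p (1 ℕ.+ n) + p n) →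
  (∀ n → q (3 ℕ.+ n) ≡ q n - q (1 ℕ.+ n) - q (2 ℕ.+ n)) →
  ∣ q 0 ∣≤ p 0 → ∣ q 1 ∣≤ p 1 → ∣ q 2 ∣< p 2 →
  ∀ n → ∣ q (2 ℕ.+ n) ∣< p (2 ℕ.+ n)
dominated p q p-rec q-rec h₀ h₁ h₂ n = proj₂ (proj₂ (window n))
  where
  window : ∀ n → ∣ q n ∣≤ p n × ∣ q (1 ℕ.+ n) ∣≤ p (1 ℕ.+ n) × ∣ q (2 ℕ.+ n) ∣< p (2 ℕ.+ n)
  window zero = h₀ , h₁ , h₂
  window (suc n) with window n
  ... | w₀ , w₁ , w₂ =
    w₁ , ∣∣<⇒∣∣≤ w₂ , subst₂ ∣_∣<_ (sym (q-rec n)) (sym (p-rec n)) (∣x-y-z∣< w₀ w₁ w₂)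

-- against K₀, K₁, K₂ = 3, 1, 3 the backward values are K₀, K₋₁, K₋₂ = 3, −1, −1
∣K₋ₙ∣<Kₙ : ∀ n → ∣ K (- + (2 ℕ.+ n)) ∣< K (+ (2 ℕ.+ n))
∣K₋ₙ∣<Kₙ = dominated (fwd (+ 3) (+ 1) (+ 3)) (bwd (+ 3) (+ 1) (+ 3))
  (fwd-tribonacci (+ 3) (+ 1) (+ 3)) (bwd-tribonacci (+ 3) (+ 1) (+ 3))
  (-≤+ , ℤ.≤-refl) (ℤ.≤-refl , -≤+) (-<- ℕ.z<s , -<+)

Kₘ≢K₋ₘ : ∀ M → K (+ suc M) - K (- + suc M) ≢ + 0
Kₘ≢K₋ₘ zero ()
Kₘ≢K₋ₘ (suc n) eq = ℤ.<⇒≢ (proj₂ (∣K₋ₙ∣<Kₙ n)) (sym (ℤ.i-j≡0⇒i≡j _ _ eq))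

mainTheorem4 : (m j : ℤ) (n : ℕ) → + 0 ≤ j → j < m → 1 ℕ.≤ n →
    (K m - K (- m) ≢ + 0)
    × ((K m - K (- m)) * sumTo n (λ i → T (m * + i + j))
         ≡ (T (m * + n + m + j) + T (m * + n - m + j) + (+ 1 - K m) * T (m * + n + j))
           - (T (m + j) + T (j - m) + (+ 1 - K m) * T j))
    × ((K m - K (- m)) * sumTo n (λ i → K (m * + i + j))
         ≡ (K (m * + n + m + j) + K (m * + n - m + j) + (+ 1 - K m) * K (m * + n + j))
           - (K (m + j) + K (j - m) + (+ 1 - K m) * K j))
mainTheorem4 m j n 0≤j j<m _ with ℤ.≤-<-trans 0≤j j<m
... | +<+ {n = suc M} _ =
    Kₘ≢K₋ₘ M
  , progression-sum T m j (K m) (K (- m)) (subsequence-recurrence T T-tribonacci (suc M)) n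
  , progression-sum K m j (K m) (K (- m)) (subsequence-recurrence K K-tribonacci (suc M)) n
  where open Progression using (progression-sum)
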